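{- Let $S$ be a recurrent specular set on a finite alphabet $A$. The even code of $S$ is an $S$-maximal bifix code of $S$-degree $2$.
   Context: Words are over a finite alphabet $A$; $\varepsilon$ is the empty word. A set $S$ of words on $A$ is factorial if it contains $A$ and all the factors of its elements. For $w\in S$ let $L(w)=\{a\in A\mid aw\in S\}$, $R(w)=\{a\in A\mid wa\in S\}$, $B(w)=\{(a,b)\in A\times A\mid awb\in S\}$. A factorial set $S$ is biextendable if $B(w)\neq\emptyset$ for all $w\in S$. The extension graph $\mathcal{E}(w)$ is the undirected graph whose vertex set is the disjoint union of $L(w)$ and $R(w)$ and whose edges are the pairs in $B(w)$. A biextendable set $S$ is a tree set of characteristic $c$ if $\mathcal{E}(w)$ is a tree for every nonempty $w\in S$ and $\mathcal{E}(\varepsilon)$ is a disjoint union of $c$ trees. Let $\theta$ be an involution on $A$ (possibly with fixed points) and let $G_\theta$ be the group generated by $A$ with relations $a\theta(a)=1$, $a\in A$ (so $a^{ -1}=\theta(a)$). A word is reduced if it has no factor $a\theta(a)$ with $a\in A$; the inverse of a reduced word $a_1\cdots a_n$ is the reduced word $\theta(a_n)\cdots\theta(a_1)$. A laminary set on $A$ relative to $\theta$ is a biextendable set of reduced words closed under taking inverses. A specular set is a laminary set which is a tree set of characteristic $2$. A set $S\ne\{\varepsilon\}$ is recurrent if it is factorial and for all $u,w\in S$ there is $v\in S$ with $uvw\in S$. In a specular set, each letter $a$ occurs exactly twice as a vertex of $\mathcal{E}(\varepsilon)$, once in $L(\varepsilon)$ and once in $R(\varepsilon)$; $a$ is even if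 both occurrences are in the same tree of $\mathcal{E}(\varepsilon)$ and odd otherwise. A word of $S$ is even if it has an even number of (occurrences of) odd letters, and odd otherwise. The even code is the set of nonempty even words of $S$ without a proper nonempty even prefix. A bifix code is a set of nonempty words in which no element is a proper prefix or a proper suffix of another. A bifix code $X\subset S$ is $S$-maximal if it is not properly contained in a bifix code $Y\subset S$. A parse of a word $w$ with respect to $X$ is a triple $(q,x,p)$ with $w=qxp$, where $q$ has no suffix in $X$, $x\in X^*$ and $p$ has no prefix in $X$. The $S$-degree of $X$ is the maximal number of parses with respect to $X$ of a word of $S$. -}

module Defs where

open import Algebra.Definitions using (Involutive)
open import Data.Fin using (Fin)
open import Data.List using (List; []; _∷_; _++_; [_]; map; reverse; concat; length)
open import Data.List.Membership.Propositional using (_∈_)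
open import Data.List.Relation.Binary.Infix.Heterogeneous using (Infix)
open import Data.List.Relation.Binary.Prefix.Heterogeneous using (Prefix)
open import Data.List.Relation.Binary.Suffix.Heterogeneous using (Suffix)
open import Data.List.Relation.Unary.All using (All)
open import Data.List.Relation.Unary.Linked using (Linked)
open import Data.List.Relation.Unary.Unique.Propositional using (Unique)
open import Data.Nat using (ℕ; zero; suc; _≤_)
open import Data.Nat.Divisibility using (_∣_)
open import Data.Product using (∃; ∃-syntax; _×_; _,_)
open import Data.Sum using (_⊎_; inj₁; inj₂)
open import Function.Bundles using (_⇔_)
open import Level using (0ℓ)
open import Relation.Binary.Core using (Rel)
open import Relation.Binary.Construct.Closure.ReflexiveTransitive using (Star)
open import Relation.Binary.PropositionalEquality using (_≡_; _≢_)
open import Relation.Nullary using (¬_)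
open import Relation.Unary using (Pred; _⊆_; _⊄_; _≐_; ｛_｝; _∩_)

-- Undirected graphs: the vertex set is a subset of an ambient type V, and
-- Edge is intended to be symmetric and to relate vertices only.

record Graph (V : Set) : Set₁ where
  field
    Vertex : Pred V 0ℓ
    Edge   : Rel V 0ℓ

module _ {V : Set} where

  open Graph

  infixl 7 _↾_

  _↾_ : Graph V → Pred V 0ℓ → Graph V
  (G ↾ P) .Vertex   = G .Vertex ∩ P
  (G ↾ P) .Edge u v = G .Edge u v × P u × P v

  SameComponent : Graph V → Rel V 0ℓ
  SameComponent G = Star (G .Edge)

  -- The cycle v, v₁, …, vₖ, v with v, v₁, …, vₖ distinct and k ≥ 2.
  record Cycle (G : Graph V) : Set where
    field
      v        : V
      vs       : List V
      long     : 2 ≤ length vs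
      distinct : Unique (v ∷ vs)
      closed   : Linked (G .Edge) (v ∷ vs ++ [ v ])

  record IsTree (G : Graph V) : Set where
    field
      nonempty  : ∃ (G .Vertex)
      connected : ∀ {u v} → G .Vertex u → G .Vertex v → SameComponent G u v
      acyclic   : ¬ Cycle G

  record IsDisjointUnionOfTrees (c : ℕ) (G : Graph V) : Set₁ where
    field
      T        : Fin c → Pred V 0ℓ
      inside   : ∀ i → T i ⊆ G .Vertex
      cover    : ∀ {v} → G .Vertex v → ∃[ i ] T i v
      disjoint : ∀ {i j v} → T i v → T j v → i ≡ j
      edges    : ∀ {i j u v} → G .Edge u v → T i u → T j v → i ≡ j
      trees    : ∀ i → IsTree (G ↾ T i)

HasCardinality : {B : Set} → Pred B 0ℓ → ℕ → Set
HasCardinality P k =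
  ∃[ xs ] Unique xs × length xs ≡ k × (∀ x → x ∈ xs ⇔ P x)

Word : Set → Set
Word A = List A

Language : Set → Set₁
Language A = Pred (Word A) 0ℓ

module _ {A : Set} where

  IsPrefix IsSuffix IsFactor ProperPrefix ProperSuffix : Rel (Word A) 0ℓ
  IsPrefix = Prefix _≡_
  IsSuffix = Suffix _≡_
  IsFactor = Infix _≡_
  ProperPrefix u w = IsPrefix u w × u ≢ w
  ProperSuffix u w = IsSuffix u w × u ≢ w

  record Factorial (S : Language A) : Set where
    field
      letters : ∀ a → S [ a ]
      factors : ∀ {u w} → IsFactor u w → S w → S u

  L R : Language A → Word A → Pred A 0ℓ
  L S w a = S (a ∷ w)
  R S w a = S (w ++ [ a ])

  B : Language A → Word A → Pred (A × A) 0ℓ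
  B S w (a , b) = S (a ∷ w ++ [ b ])

  record Biextendable (S : Language A) : Set where
    field
      factorial : Factorial S
      extend    : ∀ {w} → S w → ∃ (B S w)

  data ExtVertex (S : Language A) (w : Word A) : Pred (A ⊎ A) 0ℓ where
    left  : ∀ {a} → L S w a → ExtVertex S w (inj₁ a)
    right : ∀ {b} → R S w b → ExtVertex S w (inj₂ b)

  data ExtEdge (S : Language A) (w : Word A) : Rel (A ⊎ A) 0ℓ where
    lr : ∀ {a b} → B S w (a , b) → ExtEdge S w (inj₁ a) (inj₂ b)
    rl : ∀ {a b} → B S w (a , b) → ExtEdge S w (inj₂ b) (inj₁ a)

  ExtensionGraph : Language A → Word A → Graph (A ⊎ A)
  ExtensionGraph S w = record { Vertex = ExtVertex S w ; Edge = ExtEdge S w }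

  record TreeSet (c : ℕ) (S : Language A) : Set₁ where
    field
      biextendable : Biextendable S
      tree         : ∀ {w} → S w → w ≢ [] → IsTree (ExtensionGraph S w)
      forest       : IsDisjointUnionOfTrees c (ExtensionGraph S [])

  Reduced : (A → A) → Word A → Set
  Reduced θ w = ∀ a → ¬ IsFactor (a ∷ θ a ∷ []) w

  inverse : (A → A) → Word A → Word A
  inverse θ w = reverse (map θ w)

  record Laminary (θ : A → A) (S : Language A) : Set where
    field
      biextendable : Biextendable S
      reduced      : ∀ {w} → S w → Reduced θ w
      inverses     : ∀ {w} → S w → S (inverse θ w)

  record Specular (θ : A → A) (S : Language A) : Set₁ where
    field
      involutive : Involutive _≡_ θ
      laminary   : Laminary θ S
      treeSet    : TreeSet 2 S

  record Recurrent (S : Language A) : Set where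
    field
      nontrivial : ¬ (S ≐ ｛ [] ｝)
      factorial  : Factorial S
      recur      : ∀ {u w} → S u → S w → ∃[ v ] S v × S (u ++ v ++ w)

  -- The trees of the forest ℰ(ε) are its connected components.
  EvenLetter OddLetter : Language A → Pred A 0ℓ
  EvenLetter S a = SameComponent (ExtensionGraph S []) (inj₁ a) (inj₂ a)
  OddLetter  S a = ¬ EvenLetter S a

  -- OddLetterCount S w k: exactly k of the positions of w carry an odd letter.
  -- A relation, because membership in S is not assumed to be decidable.
  data OddLetterCount (S : Language A) : Word A → ℕ → Set where
    []   : OddLetterCount S [] zero
    even : ∀ {a w k} → EvenLetter S a → OddLetterCount S w k → OddLetterCount S (a ∷ w) k
    odd  : ∀ {a w k} → OddLetter S a → OddLetterCount S w k → OddLetterCount S (a ∷ w) (suc k)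

  EvenWord : Language A → Language A
  EvenWord S w = S w × ∃[ k ] OddLetterCount S w k × 2 ∣ k

  record EvenCode (S : Language A) (w : Word A) : Set where
    field
      evenWord : EvenWord S w
      nonempty : w ≢ []
      minimal  : ∀ {p} → EvenWord S p → p ≢ [] → ¬ ProperPrefix p w

  record BifixCode (X : Language A) : Set where
    field
      nonempty   : ∀ {x} → X x → x ≢ []
      prefixFree : ∀ {x y} → X x → X y → ¬ ProperPrefix x y
      suffixFree : ∀ {x y} → X x → X y → ¬ ProperSuffix x y

  record MaximalBifixCode (S X : Language A) : Set₁ where
    field
      bifix    : BifixCode X
      included : X ⊆ S
      maximal  : ∀ (Y : Language A) → BifixCode Y → Y ⊆ S → X ⊄ Y

  -- The submonoid X* generated by X.
  _⋆ : Language A → Language A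
  (X ⋆) x = ∃[ xs ] All X xs × concat xs ≡ x

  record IsParse (X : Language A) (w q x p : Word A) : Set where
    field
      factorization : w ≡ q ++ x ++ p
      noSuffix      : ∀ {s} → IsSuffix s q → ¬ X s
      middle        : (X ⋆) x
      noPrefix      : ∀ {s} → IsPrefix s p → ¬ X s

  ParseCount : Language A → Word A → ℕ → Set
  ParseCount X w = HasCardinality λ ((q , x , p) : Word A × Word A × Word A) → IsParse X w q x p

  record HasDegree (S X : Language A) (d : ℕ) : Set where
    field
      attained : ∃[ w ] S w × ParseCount X w d
      bounded  : ∀ {w} → S w → ∃[ k ] ParseCount X w k × k ≤ d

{-# OPTIONS --safe #-}

-- Colour each vertex of ℰ(ε) by its tree. If ab ∈ S then the left vertex a and
-- the right vertex b have the same colour, so reading a word of S moves between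
-- the two colours, changing colour exactly at the odd letters, and a factor is
-- even iff it starts and ends at the same colour. The even code thus consists
-- of the first returns to a colour, and a parse of a word w ∈ S is determined
-- by the colour at its cutting points: there is one for each colour visited by w.
-- Recurrence makes every word extend to one that returns to its initial colour
-- (maximality) and yields a word visiting both colours (degree 2).

module Submission where

open import Data.Empty using (⊥-elim)
open import Data.Fin using (Fin; zero; suc)
open import Data.List using (List; []; _∷_; _++_; [_]; concat; length)
open import Data.List.Membership.Propositional using (_∈_)
open import Data.List.Properties using (++-assoc; ++-identityʳ; ++-identityʳ-unique; ++-conicalˡ; ++-conicalʳ; ++-cancelˡ; length-++; ∷-injective)
open import Data.List.Relation.Binary.Infix.Heterogeneous using (MkView) renaming (fromView to fromInfixView)
open import Data.List.Relation.Binary.Pointwise using (≡⇒Pointwise-≡; Pointwise-≡⇒≡)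
open import Data.List.Relation.Binary.Prefix.Heterogeneous using () renaming (_++_ to _++ᵖ_; toView to toPrefixView; fromView to fromPrefixView)
open import Data.List.Relation.Binary.Suffix.Heterogeneous using () renaming (_++_ to _++ˢ_; toView to toSuffixView; fromView to fromSuffixView)
open import Data.List.Relation.Unary.All using (All; []; _∷_)
open import Data.List.Relation.Unary.AllPairs using ([]; _∷_)
open import Data.List.Relation.Unary.Any using (here; there)
open import Data.Nat using (ℕ; zero; suc; _≤_; _<_; z≤n; s≤s; parity)
open import Data.Nat.Divisibility using (_∣_; divides)
open import Data.Nat.Induction using (<-wellFounded)
open import Data.Nat.Properties using (≤-refl; m≤n+m)
open import Data.Parity.Base using (Parity; 0ℙ; 1ℙ; _+_; _⁻¹)
open import Data.Parity.Properties using (suc-homo-⁻¹; ⁻¹-selfInverse; p+p≡0ℙ; +-assoc; +-identityʳ; +-cancelˡ-≡)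
open import Data.Product using (∃-syntax; _×_; _,_; proj₁; proj₂)
open import Data.Sum using (_⊎_; inj₁; inj₂)
open import Function.Base using (_∘_; case_of_)
open import Function.Bundles using (_↔_; mk⇔)
open import Induction.WellFounded using (Acc; acc)
open import Relation.Binary.Construct.Closure.ReflexiveTransitive using (ε; _◅_) renaming (map to mapStar)
open import Relation.Binary.PropositionalEquality using (_≡_; _≢_; refl; sym; trans; cong; cong₂; subst; module ≡-Reasoning)
open import Relation.Nullary using (¬_)
open import Relation.Unary using (_⊆_)
open import Defs hiding (even; odd)

-- Arithmetic modulo 2.

parity-suc : ∀ k → parity (suc k) ≡ parity k ⁻¹
parity-suc k = sym (⁻¹-selfInverse (suc-homo-⁻¹ k))

even⇒2∣ : ∀ k → parity k ≡ 0ℙ → 2 ∣ k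
even⇒2∣ zero          _ = divides 0 refl
even⇒2∣ (suc (suc k)) e with even⇒2∣ k e
... | divides q refl = divides (suc q) refl

2∣⇒even : ∀ {k} → 2 ∣ k → parity k ≡ 0ℙ
2∣⇒even (divides zero    refl) = refl
2∣⇒even (divides (suc q) refl) = 2∣⇒even (divides q refl)

≢0⇒≡1 : ∀ {p} → p ≢ 0ℙ → p ≡ 1ℙ
≢0⇒≡1 {0ℙ} p≢0 = ⊥-elim (p≢0 refl)
≢0⇒≡1 {1ℙ} p≢0 = refl

1≢0 : 1ℙ ≢ 0ℙ
1≢0 ()

p+q≡0⇒p≡q : ∀ {p q} → p + q ≡ 0ℙ → p ≡ q
p+q≡0⇒p≡q {0ℙ} e = sym e
p+q≡0⇒p≡q {1ℙ} {1ℙ} e = refl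

p+[p+q]≡q : ∀ p q → p + (p + q) ≡ q
p+[p+q]≡q p q = trans (sym (+-assoc p p q)) (cong (_+ q) (p+p≡0ℙ p))

-- Prefixes, suffixes and factorizations of words.

module _ {A : Set} where

  prefix⁺ : (u v : Word A) → IsPrefix u (u ++ v)
  prefix⁺ u v = fromPrefixView (≡⇒Pointwise-≡ refl ++ᵖ v)

  prefix⁻ : {u w : Word A} → IsPrefix u w → ∃[ v ] w ≡ u ++ v
  prefix⁻ p with toPrefixView p
  ... | eq ++ᵖ v = v , cong (_++ v) (sym (Pointwise-≡⇒≡ eq))

  suffix⁺ : (u v : Word A) → IsSuffix v (u ++ v)
  suffix⁺ u v = fromSuffixView (u ++ˢ ≡⇒Pointwise-≡ refl)

  suffix⁻ : {v w : Word A} → IsSuffix v w → ∃[ u ] w ≡ u ++ v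
  suffix⁻ p with toSuffixView p
  ... | u ++ˢ eq = u , cong (u ++_) (sym (Pointwise-≡⇒≡ eq))

  properPrefix⁺ : (u : Word A) {v : Word A} → v ≢ [] → ProperPrefix u (u ++ v)
  properPrefix⁺ u {v} v≢[] = prefix⁺ u v , λ eq → v≢[] (++-identityʳ-unique u eq)

  properPrefix⁻ : {u w : Word A} → ProperPrefix u w → ∃[ v ] w ≡ u ++ v × v ≢ []
  properPrefix⁻ {u} (pre , u≢w) with prefix⁻ pre
  ... | v , refl = v , refl , λ { refl → u≢w (sym (++-identityʳ u)) }

  properSuffix⁻ : {v w : Word A} → ProperSuffix v w → ∃[ u ] w ≡ u ++ v × u ≢ []
  properSuffix⁻ (suf , v≢w) with suffix⁻ suf
  ... | u , refl = u , refl , λ { refl → v≢w refl }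

  -- Levi's lemma: one of two cuts of a word comes first, and `z` is the piece between them.
  ++-compare : (u u′ : Word A) {v v′ : Word A} → u ++ v ≡ u′ ++ v′ →
    (∃[ z ] u′ ≡ u ++ z × v ≡ z ++ v′) ⊎ (∃[ z ] u ≡ u′ ++ z × v′ ≡ z ++ v)
  ++-compare []      u′       eq = inj₁ (u′ , refl , eq)
  ++-compare (a ∷ u) []       eq = inj₂ (a ∷ u , refl , sym eq)
  ++-compare (a ∷ u) (b ∷ u′) eq with ∷-injective eq
  ... | refl , eq′ with ++-compare u u′ eq′
  ...   | inj₁ (z , refl , eq″) = inj₁ (z , refl , eq″)
  ...   | inj₂ (z , refl , eq″) = inj₂ (z , refl , eq″)

  -- Supplies the code word that ends a nonempty product, for `noSuffix⇒`.
  lastFactor : {X : Language A} → ∀ {x xs} → All X (x ∷ xs) →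
    ∃[ u ] ∃[ y ] X y × concat (x ∷ xs) ≡ u ++ y
  lastFactor {x = x} (px ∷ []) = [] , x , px , ++-identityʳ x
  lastFactor {x = x} (_ ∷ pxs@(_ ∷ _)) with lastFactor pxs
  ... | u , y , py , eq = x ++ u , y , py , trans (cong (x ++_) eq) (sym (++-assoc x u y))

-- Morphisms from words to ℤ/2ℤ

module _ {A : Set} (π : A → Parity) where

  weight : Word A → Parity
  weight []      = 0ℙ
  weight (a ∷ w) = π a + weight w

  weight-++ : ∀ u v → weight (u ++ v) ≡ weight u + weight v
  weight-++ []      v = refl
  weight-++ (a ∷ u) v = trans (cong (π a +_) (weight-++ u v)) (sym (+-assoc (π a) (weight u) (weight v)))

  weight-suffix : ∀ {u v} → weight (u ++ v) ≡ weight u → weight v ≡ 0ℙ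
  weight-suffix {u} {v} e = +-cancelˡ-≡ (weight u) _ _ (trans (sym (weight-++ u v)) (trans e (sym (+-identityʳ _))))

  -- For `w` in `S` these turn out to say that `w` has no prefix in the even code, has no suffix in
  -- it, and belongs to it. A nonempty `w` counts among its own prefixes and suffixes in the first
  -- two, and is excluded in the third.
  OddPrefixes OddSuffixes FirstReturn : Word A → Set
  OddPrefixes w = ∀ u v → w ≡ u ++ v → u ≢ [] → weight u ≡ 1ℙ
  OddSuffixes w = ∀ u v → w ≡ u ++ v → v ≢ [] → weight v ≡ 1ℙ
  FirstReturn w = weight w ≡ 0ℙ × w ≢ [] × (∀ u v → w ≡ u ++ v → u ≢ [] → v ≢ [] → weight u ≡ 1ℙ)

  -- The prefix found is the shortest one of weight `c`, which `OddSuffixes q` expresses: removing a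
  -- nonempty even suffix would leave a shorter prefix of the same weight. Once a letter `a` is
  -- read, the weight still missing is `π a + c`.
  firstHit : ∀ c w →
    (∃[ q ] ∃[ r ] w ≡ q ++ r × weight q ≡ c × OddSuffixes q) ⊎
    (∀ q r → w ≡ q ++ r → weight q ≢ c)
  firstHit 0ℙ w = inj₁ ([] , w , refl , refl , λ u v eq v≢[] → ⊥-elim (v≢[] (++-conicalʳ u v (sym eq))))
  firstHit 1ℙ [] = inj₂ λ { [] r eq () }
  firstHit 1ℙ (a ∷ w) with firstHit (π a + 1ℙ) w
  ... | inj₁ (q , r , refl , hit , odd) = inj₁ (a ∷ q , r , refl , hit′ , odd′)
    where
    hit′ : π a + weight q ≡ 1ℙ
    hit′ = trans (cong (π a +_) hit) (p+[p+q]≡q (π a) 1ℙ)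
    odd′ : OddSuffixes (a ∷ q)
    -- The suffix that is the whole word is odd because the target weight is `1ℙ` here.
    odd′ []      v refl _    = hit′
    odd′ (_ ∷ u) v refl v≢[] = odd u v refl v≢[]
  ... | inj₂ none = inj₂ λ where
    (_ ∷ q) r refl hit → none q r refl (trans (sym (p+[p+q]≡q (π a) (weight q))) (cong (π a +_) hit))

  -- Dual to `firstHit`: the longest such prefix, recorded by `OddPrefixes` of the remainder. The
  -- tail is searched first, and the empty prefix is tried when that fails.
  lastHit : ∀ c w →
    (∃[ x ] ∃[ p ] w ≡ x ++ p × weight x ≡ c × OddPrefixes p) ⊎
    (∀ x p → w ≡ x ++ p → weight x ≢ c)
  lastHit 0ℙ [] = inj₁ ([] , [] , refl , refl , λ u v eq u≢[] → ⊥-elim (u≢[] (++-conicalˡ u v (sym eq))))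
  lastHit 1ℙ [] = inj₂ λ { [] p eq () }
  lastHit c (a ∷ w) with lastHit (π a + c) w
  ... | inj₁ (x , p , refl , hit , odd) =
        inj₁ (a ∷ x , p , refl , trans (cong (π a +_) hit) (p+[p+q]≡q (π a) c) , odd)
  ... | inj₂ none = late c none
    where
    late : ∀ c → (∀ x p → w ≡ x ++ p → weight x ≢ π a + c) →
      (∃[ x ] ∃[ p ] a ∷ w ≡ x ++ p × weight x ≡ c × OddPrefixes p) ⊎
      (∀ x p → a ∷ w ≡ x ++ p → weight x ≢ c)
    late 0ℙ none = inj₁ ([] , a ∷ w , refl , refl , λ where
      []      v eq   u≢[] → ⊥-elim (u≢[] refl)
      -- If `a ∷ u` were even, `u` would be a prefix of `w` of weight `π a`, which the tail search
      -- excluded.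
      (_ ∷ u) v refl _    → ≢0⇒≡1 λ e → none u v refl (sym (trans (+-identityʳ (π a)) (p+q≡0⇒p≡q e))))
    late 1ℙ none = inj₂ λ where
      (_ ∷ x) p refl hit → none x p refl (trans (sym (p+[p+q]≡q (π a) (weight x))) (cong (π a +_) hit))

  lastEven : ∀ w → ∃[ x ] ∃[ p ] w ≡ x ++ p × weight x ≡ 0ℙ × OddPrefixes p
  lastEven w with lastHit 0ℙ w
  ... | inj₁ hit  = hit
  ... | inj₂ none = ⊥-elim (none [] w refl refl)

  -- A prefix `a ∷ q` is even exactly when `q` has weight `π a`, so the search is `firstHit` on the
  -- tail.
  firstReturn : ∀ w → (∃[ x ] ∃[ r ] w ≡ x ++ r × FirstReturn x) ⊎ OddPrefixes w
  firstReturn [] = inj₂ λ u v eq u≢[] → ⊥-elim (u≢[] (++-conicalˡ u v (sym eq)))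
  firstReturn (a ∷ w) with firstHit (π a) w
  ... | inj₁ (q , r , refl , hit , odd) = inj₁ (a ∷ q , r , refl , returns , (λ ()) , first)
    where
    returns : π a + weight q ≡ 0ℙ
    returns = trans (cong (π a +_) hit) (p+p≡0ℙ (π a))
    first : ∀ u v → a ∷ q ≡ u ++ v → u ≢ [] → v ≢ [] → weight u ≡ 1ℙ
    first []      v eq   u≢[] _    = ⊥-elim (u≢[] refl)
    -- The total weight is zero, so the prefix weighs as much as the complementary suffix `v` of
    -- `q`, which is odd by the choice of `q`.
    first (_ ∷ u) v refl _    v≢[] = begin
      weight (a ∷ u) ≡⟨ p+q≡0⇒p≡q (trans (sym (weight-++ (a ∷ u) v)) returns) ⟩
      weight v       ≡⟨ odd u v refl v≢[] ⟩
      1ℙ             ∎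
      where open ≡-Reasoning
  ... | inj₂ none = inj₂ λ where
    []      v eq   u≢[] → ⊥-elim (u≢[] refl)
    (_ ∷ u) v refl _    → ≢0⇒≡1 λ e → none u v refl (sym (p+q≡0⇒p≡q e))

  even⇒firstReturn : ∀ {w} → weight w ≡ 0ℙ → w ≢ [] → ∃[ x ] ∃[ r ] w ≡ x ++ r × FirstReturn x
  even⇒firstReturn {w} e w≢[] with firstReturn w
  ... | inj₁ ret = ret
  ... | inj₂ odd = ⊥-elim (1≢0 (trans (sym (odd w [] (sym (++-identityʳ w)) w≢[])) e))

  -- The piece between two distinct cuts of equal weight would be a nonempty even suffix of the
  -- longer prefix.
  oddSuffixes-unique : ∀ {q q′ r r′} → q ++ r ≡ q′ ++ r′ → weight q ≡ weight q′ →
    OddSuffixes q → OddSuffixes q′ → q ≡ q′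
  oddSuffixes-unique {q} {q′} eq e odd odd′ with ++-compare q q′ eq
  ... | inj₁ ([]    , refl , _) = sym (++-identityʳ q)
  ... | inj₁ (a ∷ z , refl , _) = ⊥-elim (1≢0 (trans (sym (odd′ q (a ∷ z) refl λ ())) (weight-suffix {q} (sym e))))
  ... | inj₂ ([]    , refl , _) = ++-identityʳ q′
  ... | inj₂ (a ∷ z , refl , _) = ⊥-elim (1≢0 (trans (sym (odd q′ (a ∷ z) refl λ ())) (weight-suffix {q′} e)))

  -- Here the piece between the cuts would be a nonempty even prefix of the longer remainder.
  oddPrefixes-unique : ∀ {x x′ p p′} → x ++ p ≡ x′ ++ p′ → weight x ≡ weight x′ →
    OddPrefixes p → OddPrefixes p′ → x ≡ x′
  oddPrefixes-unique {x} {x′} eq e odd odd′ with ++-compare x x′ eq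
  ... | inj₁ ([]    , refl , _)    = sym (++-identityʳ x)
  ... | inj₁ (a ∷ z , refl , refl) = ⊥-elim (1≢0 (trans (sym (odd (a ∷ z) _ refl λ ())) (weight-suffix {x} (sym e))))
  ... | inj₂ ([]    , refl , _)    = ++-identityʳ x′
  ... | inj₂ (a ∷ z , refl , refl) = ⊥-elim (1≢0 (trans (sym (odd′ (a ∷ z) _ refl λ ())) (weight-suffix {x′} e)))

-- The even code

module _ {A : Set} {S : Language A} (factorial : Factorial S) where

  open Factorial factorial

  factor : ∀ u {v} w → S (u ++ v ++ w) → S v
  factor u w = factors (fromInfixView (MkView u (≡⇒Pointwise-≡ refl) w))

  factorˡ : ∀ u {v} → S (u ++ v) → S u
  factorˡ u {v} = factor [] v

  factorʳ : ∀ u {v} → S (u ++ v) → S v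
  factorʳ u {v} s = factor u [] (subst (λ z → S (u ++ z)) (sym (++-identityʳ v)) s)

  -- The colouring is kept out of this part: `π` is any map to ℤ/2ℤ that tells even letters from odd
  -- ones.
  module _ (π : A → Parity)
           (π≡0⇒even : ∀ {a} → π a ≡ 0ℙ → EvenLetter S a)
           (π≡1⇒odd  : ∀ {a} → π a ≡ 1ℙ → OddLetter S a) where

    weight-count : ∀ {w k} → OddLetterCount S w k → weight π w ≡ parity k
    weight-count [] = refl
    weight-count (OddLetterCount.even {a} e count) with π a in eq
    ... | 0ℙ = weight-count count
    ... | 1ℙ = ⊥-elim (π≡1⇒odd eq e)
    weight-count (OddLetterCount.odd {a} {k = k} o count) with π a in eq
    ... | 0ℙ = ⊥-elim (o (π≡0⇒even eq))
    ... | 1ℙ = trans (cong _⁻¹ (weight-count count)) (sym (parity-suc k))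

    -- `π` decides the parity of each letter, so the count exists although `EvenLetter` is not
    -- assumed decidable.
    count-odd : ∀ w → ∃[ k ] OddLetterCount S w k
    count-odd [] = 0 , []
    count-odd (a ∷ w) with π a in eq | count-odd w
    ... | 0ℙ | k , count = k , OddLetterCount.even (π≡0⇒even eq) count
    ... | 1ℙ | k , count = suc k , OddLetterCount.odd (π≡1⇒odd eq) count

    evenWord⇒ : ∀ {w} → EvenWord S w → weight π w ≡ 0ℙ
    evenWord⇒ (_ , k , count , 2∣k) = trans (weight-count count) (2∣⇒even 2∣k)

    evenWord⇐ : ∀ {w} → S w → weight π w ≡ 0ℙ → EvenWord S w
    evenWord⇐ {w} s e with count-odd w
    ... | k , count = s , k , count , even⇒2∣ k (trans (sym (weight-count count)) e)

    evenCode⇒ : ∀ {w} → EvenCode S w → S w × FirstReturn π w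
    evenCode⇒ {w} X = proj₁ evenWord , evenWord⇒ evenWord , nonempty , first
      where
      open EvenCode X
      first : ∀ u v → w ≡ u ++ v → u ≢ [] → v ≢ [] → weight π u ≡ 1ℙ
      first u v refl u≢[] v≢[] = ≢0⇒≡1 λ e →
        minimal (evenWord⇐ (factorˡ u (proj₁ evenWord)) e) u≢[] (properPrefix⁺ u v≢[])

    evenCode⇐ : ∀ {w} → S w → FirstReturn π w → EvenCode S w
    evenCode⇐ s (e , w≢[] , first) = record
      { evenWord = evenWord⇐ s e
      ; nonempty = w≢[]
      ; minimal  = λ {p} even p≢[] proper → case properPrefix⁻ proper of λ where
          (v , eq , v≢[]) → 1≢0 (trans (sym (first p v eq p≢[] v≢[])) (evenWord⇒ even))
      }

    evenCode-bifix : BifixCode (EvenCode S)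
    evenCode-bifix = record
      { nonempty   = EvenCode.nonempty
      ; prefixFree = λ X Y → EvenCode.minimal Y (EvenCode.evenWord X) (EvenCode.nonempty X)
      ; suffixFree = suffixFree
      }
      where
      suffixFree : ∀ {x y} → EvenCode S x → EvenCode S y → ¬ ProperSuffix x y
      suffixFree {x} X Y proper with properSuffix⁻ proper | evenCode⇒ X | evenCode⇒ Y
      ... | u , refl , u≢[] | _ , ex , x≢[] , _ | _ , ey , _ , first =
        -- `y` and its suffix `x` are both even, hence so is the proper prefix `u`, although `y` is
        -- a first return.
        1≢0 (begin
          1ℙ         ≡⟨ first u x refl u≢[] x≢[] ⟨
          weight π u ≡⟨ p+q≡0⇒p≡q (trans (sym (weight-++ π u x)) ey) ⟩
          weight π x ≡⟨ ex ⟩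
          0ℙ         ∎)
        where open ≡-Reasoning

    -- A nonempty even word starts with a first return, and what follows is again even. The
    -- recursion is on length, since that remainder is not a structural subterm.
    even⇒⋆ : ∀ {w} → S w → weight π w ≡ 0ℙ → (EvenCode S ⋆) w
    even⇒⋆ {w} = go w (<-wellFounded (length w))
      where
      go : ∀ w → Acc _<_ (length w) → S w → weight π w ≡ 0ℙ → (EvenCode S ⋆) w
      go [] _ _ _ = [] , [] , refl
      go w@(_ ∷ _) (acc rec) s e with even⇒firstReturn π {w} e (λ ())
      ... | []    , r , _    , _ , x≢[] , _ = ⊥-elim (x≢[] refl)
      ... | a ∷ x , r , refl , ret@(ex , _)
        with xs , Xs , eq ← go r (rec (s≤s (subst (length r ≤_) (sym (length-++ x)) (m≤n+m _ _))))
                               (factorʳ (a ∷ x) s) (weight-suffix π {a ∷ x} (trans e (sym ex)))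
        = (a ∷ x) ∷ xs , evenCode⇐ (factorˡ (a ∷ x) s) ret ∷ Xs , cong ((a ∷ x) ++_) eq

    ⋆⇒even : ∀ {w} → (EvenCode S ⋆) w → weight π w ≡ 0ℙ
    ⋆⇒even ([]     , []     , refl) = refl
    ⋆⇒even (x ∷ xs , X ∷ Xs , refl) = begin
      weight π (x ++ concat xs)         ≡⟨ weight-++ π x (concat xs) ⟩
      weight π x + weight π (concat xs) ≡⟨ cong₂ _+_ (proj₁ (proj₂ (evenCode⇒ X))) (⋆⇒even (xs , Xs , refl)) ⟩
      0ℙ                                ∎
      where open ≡-Reasoning

    -- Parses with respect to the even code.

    noPrefix⇒ : ∀ {p} → S p → (∀ {s} → IsPrefix s p → ¬ EvenCode S s) → OddPrefixes π p
    -- A nonempty even prefix would itself begin with a first return, which is a code word.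
    noPrefix⇒ s none u v refl u≢[] = ≢0⇒≡1 λ e → case even⇒firstReturn π {u} e u≢[] of λ where
      (x , r , refl , ret) → none (subst (IsPrefix x) (sym (++-assoc x r v)) (prefix⁺ x (r ++ v)))
                                  (evenCode⇐ (factorˡ x (factorˡ (x ++ r) s)) ret)

    noPrefix⇐ : ∀ {p} → OddPrefixes π p → ∀ {s} → IsPrefix s p → ¬ EvenCode S s
    noPrefix⇐ odd {s} pre X with prefix⁻ pre | evenCode⇒ X
    ... | v , eq | _ , e , s≢[] , _ = 1≢0 (trans (sym (odd s v eq s≢[])) e)

    -- First returns are read from the left, so an even suffix is decomposed into code words, and
    -- the last of these is a suffix in the code.
    noSuffix⇒ : ∀ {q} → S q → (∀ {s} → IsSuffix s q → ¬ EvenCode S s) → OddSuffixes π q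
    noSuffix⇒ s none u v refl v≢[] = ≢0⇒≡1 λ e → case even⇒⋆ (factorʳ u s) e of λ where
      ([]     , _  , refl) → v≢[] refl
      (x ∷ xs , Xs , refl) → case lastFactor Xs of λ where
        (z , y , Y , eq) → none (subst (IsSuffix y) (trans (++-assoc u z y) (cong (u ++_) (sym eq))) (suffix⁺ (u ++ z) y)) Y

    noSuffix⇐ : ∀ {q} → OddSuffixes π q → ∀ {s} → IsSuffix s q → ¬ EvenCode S s
    noSuffix⇐ odd {s} suf X with suffix⁻ suf | evenCode⇒ X
    ... | u , eq | _ , e , s≢[] , _ = 1≢0 (trans (sym (odd u s eq s≢[])) e)

    Parse : Word A → Word A × Word A × Word A → Set
    Parse w (q , x , p) = IsParse (EvenCode S) w q x p

    -- Once `q` is chosen, the rest is cut at the end of its longest even prefix.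
    parse-at : ∀ {w} → S w → ∀ q r → w ≡ q ++ r → OddSuffixes π q → ∃[ x ] ∃[ p ] Parse w (q , x , p)
    parse-at s q r refl odd with lastEven π r
    ... | x , p , refl , e , oddp = x , p , record
      { factorization = refl
      ; noSuffix      = noSuffix⇐ odd
      ; middle        = even⇒⋆ (factor q p s) e
      ; noPrefix      = noPrefix⇐ oddp
      }

    -- Equal weights force equal `q` by `oddSuffixes-unique`; both middles are even, so
    -- `oddPrefixes-unique` identifies them, and cancellation gives `p`.
    parse-unique : ∀ {w q q′ x x′ p p′} → S w → Parse w (q , x , p) → Parse w (q′ , x′ , p′) →
      weight π q ≡ weight π q′ → (q , x , p) ≡ (q′ , x′ , p′)
    parse-unique {w} {q} {q′} {x} {x′} {p} {p′} s P P′ e = same q≡q′ x≡x′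
      where
      module P  = IsParse P
      module P′ = IsParse P′
      w≡w : q ++ x ++ p ≡ q′ ++ x′ ++ p′
      w≡w = trans (sym P.factorization) P′.factorization
      sP : S (q ++ x ++ p)
      sP = subst S P.factorization s
      sP′ : S (q′ ++ x′ ++ p′)
      sP′ = subst S P′.factorization s
      q≡q′ : q ≡ q′
      q≡q′ = oddSuffixes-unique π w≡w e (noSuffix⇒ (factorˡ q sP) P.noSuffix) (noSuffix⇒ (factorˡ q′ sP′) P′.noSuffix)
      xp≡xp : x ++ p ≡ x′ ++ p′
      xp≡xp = ++-cancelˡ q _ _ (trans w≡w (cong (_++ x′ ++ p′) (sym q≡q′)))
      x≡x′ : x ≡ x′
      x≡x′ = oddPrefixes-unique π xp≡xp (trans (⋆⇒even P.middle) (sym (⋆⇒even P′.middle)))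
        (noPrefix⇒ (factorʳ x (factorʳ q sP)) P.noPrefix) (noPrefix⇒ (factorʳ x′ (factorʳ q′ sP′)) P′.noPrefix)
      same : q ≡ q′ → x ≡ x′ → (q , x , p) ≡ (q′ , x′ , p′)
      same refl refl = cong (λ z → q , x , z) (++-cancelˡ x _ _ xp≡xp)

    even-parse : ∀ {w} → S w → ∃[ x ] ∃[ p ] Parse w ([] , x , p)
    even-parse {w} s = parse-at s [] w refl λ u v eq v≢[] → ⊥-elim (v≢[] (++-conicalʳ u v (sym eq)))

    -- Since `w` has no odd prefix, `q` is even in every parse, as in the one with `q` empty;
    -- `parse-unique` identifies the two.
    one-parse : ∀ {w} → S w → (∀ u v → w ≡ u ++ v → weight π u ≢ 1ℙ) → ParseCount (EvenCode S) w 1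
    one-parse {w} s even with even-parse s
    ... | x₀ , p₀ , P₀ = [ [] , x₀ , p₀ ] , [] ∷ [] , refl , λ (q , x , p) → mk⇔ to (from q x p)
      where
      to : ∀ {t} → t ∈ [ [] , x₀ , p₀ ] → Parse w t
      to (here refl) = P₀
      from : ∀ q x p → Parse w (q , x , p) → (q , x , p) ∈ [ [] , x₀ , p₀ ]
      from q x p P with weight π q in e
      ... | 0ℙ = here (parse-unique s P P₀ e)
      ... | 1ℙ = ⊥-elim (even q (x ++ p) (IsParse.factorization P) e)

    -- `u` merely witnesses that an odd prefix exists; the second parse is cut at the shortest one,
    -- `q₁`. As weights take two values, there is no third parse.
    two-parses : ∀ {w} → S w → ∀ u v → w ≡ u ++ v → weight π u ≡ 1ℙ → ParseCount (EvenCode S) w 2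
    two-parses {w} s u v w≡uv odd with firstHit π 1ℙ w
    ... | inj₂ none = ⊥-elim (none u v w≡uv odd)
    ... | inj₁ (q₁ , r , eq , e₁ , oddSuffixes) with even-parse s | parse-at s q₁ r eq oddSuffixes
    ...   | x₀ , p₀ , P₀ | x₁ , p₁ , P₁ = ts , (distinct ∷ []) ∷ [] ∷ [] , refl , λ (q , x , p) → mk⇔ to (from q x p)
      where
      ts : List (Word A × Word A × Word A)
      ts = ([] , x₀ , p₀) ∷ (q₁ , x₁ , p₁) ∷ []
      distinct : ([] , x₀ , p₀) ≢ (q₁ , x₁ , p₁)
      distinct e = 1≢0 (trans (sym e₁) (cong (weight π ∘ proj₁) (sym e)))
      to : ∀ {t} → t ∈ ts → Parse w t
      to (here refl)         = P₀
      to (there (here refl)) = P₁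
      from : ∀ q x p → Parse w (q , x , p) → (q , x , p) ∈ ts
      from q x p P with weight π q in e
      ... | 0ℙ = here (parse-unique s P P₀ e)
      ... | 1ℙ = there (here (parse-unique s P P₁ (trans e (sym e₁))))

    parseCount≤2 : ∀ {w} → S w → ∃[ k ] ParseCount (EvenCode S) w k × k ≤ 2
    parseCount≤2 {w} s with firstHit π 1ℙ w
    ... | inj₁ (q , r , eq , e , _) = 2 , two-parses s q r eq e , ≤-refl
    ... | inj₂ even                 = 1 , one-parse s even , s≤s z≤n

    evenCode-degree : ∀ {w} → S w → weight π w ≡ 1ℙ → HasDegree S (EvenCode S) 2
    evenCode-degree {w} s odd = record
      { attained = w , s , two-parses s w [] (sym (++-identityʳ w)) odd
      ; bounded  = parseCount≤2
      }

    -- Let `y` lie in a bifix code `Y` containing the even code, and extend it to an even word of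
    -- `S`. The first return `x` that starts this word also lies in `Y`, and `x` and `y` are
    -- prefixes of one word, so prefix-freeness makes them equal.
    evenCode-maximal : (∀ {y} → S y → y ≢ [] → ∃[ v ] S (y ++ v) × weight π (y ++ v) ≡ 0ℙ) →
      MaximalBifixCode S (EvenCode S)
    evenCode-maximal returns = record
      { bifix    = evenCode-bifix
      ; included = proj₁ ∘ EvenCode.evenWord
      ; maximal  = λ Y bifix Y⊆S (X⊆Y , Y⊈X) → Y⊈X (contained Y bifix Y⊆S X⊆Y)
      }
      where
      contained : ∀ Y → BifixCode Y → Y ⊆ S → EvenCode S ⊆ Y → Y ⊆ EvenCode S
      contained Y bifix Y⊆S X⊆Y {y} Yy with returns (Y⊆S Yy) (BifixCode.nonempty bifix Yy)
      ... | v , s , e with even⇒firstReturn π {y ++ v} e (BifixCode.nonempty bifix Yy ∘ ++-conicalˡ y v)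
      ...   | x , r , eq , ret = result
        where
        X : EvenCode S x
        X = evenCode⇐ (factorˡ x (subst S eq s)) ret
        result : EvenCode S y
        result with ++-compare x y (sym eq)
        ... | inj₁ ([]    , refl , _) = subst (EvenCode S) (sym (++-identityʳ x)) X
        ... | inj₁ (a ∷ z , refl , _) = ⊥-elim (BifixCode.prefixFree bifix (X⊆Y X) Yy (properPrefix⁺ x λ ()))
        ... | inj₂ ([]    , refl , _) = subst (EvenCode S) (++-identityʳ y) X
        ... | inj₂ (a ∷ z , refl , _) = ⊥-elim (BifixCode.prefixFree bifix Yy (X⊆Y X) (properPrefix⁺ y λ ()))

-- The two trees of ℰ(ε)

colour : Fin 2 → Parity
colour zero       = 0ℙ
colour (suc zero) = 1ℙ

colour-injective : ∀ {i j} → colour i ≡ colour j → i ≡ j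
colour-injective {zero}     {zero}     _ = refl
colour-injective {zero}     {suc zero} ()
colour-injective {suc zero} {zero}     ()
colour-injective {suc zero} {suc zero} _ = refl

module _ {A : Set} {S : Language A} (treeSet : TreeSet 2 S) where

  open TreeSet treeSet using (biextendable; forest)
  open Biextendable biextendable
  open Factorial factorial
  open IsDisjointUnionOfTrees forest

  -- Lets `cover` assign a tree to each vertex met along a path.
  target : ∀ {u v} → ExtEdge S [] u v → ExtVertex S [] v
  target (lr {b = b} _) = right (letters b)
  target (rl {a = a} _) = left (letters a)

  -- Edges never leave a tree, so the index is constant along a path.
  tree-index : ∀ {i j u v} → SameComponent (ExtensionGraph S []) u v → T i u → T j v → i ≡ j
  tree-index ε             Tu Tv = disjoint Tu Tv
  tree-index (edge ◅ path) Tu Tv with cover (target edge)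
  ... | k , Tk = trans (edges edge Tu Tk) (tree-index path Tk Tv)

  leftTree rightTree : A → Fin 2
  leftTree  a = proj₁ (cover (left (letters a)))
  rightTree a = proj₁ (cover (right (letters a)))

  -- Reading a moves from the colour of the right vertex a to that of the left vertex a.
  letterParity : A → Parity
  letterParity a = colour (rightTree a) + colour (leftTree a)

  letterParity≡0⇒even : ∀ {a} → letterParity a ≡ 0ℙ → EvenLetter S a
  letterParity≡0⇒even {a} e with cover (left (letters a)) | cover (right (letters a))
  ... | i , Tl | j , Tr with colour-injective {j} {i} (p+q≡0⇒p≡q e)
  ...   | refl = mapStar proj₁ (IsTree.connected (trees i) (left (letters a) , Tl) (right (letters a) , Tr))

  letterParity≡1⇒odd : ∀ {a} → letterParity a ≡ 1ℙ → OddLetter S a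
  letterParity≡1⇒odd {a} e path = 1≢0 (begin
    1ℙ                                          ≡⟨ e ⟨
    colour (rightTree a) + colour (leftTree a)  ≡⟨ cong (λ i → colour (rightTree a) + colour i) same ⟩
    colour (rightTree a) + colour (rightTree a) ≡⟨ p+p≡0ℙ (colour (rightTree a)) ⟩
    0ℙ                                          ∎)
    where
    open ≡-Reasoning
    same : leftTree a ≡ rightTree a
    same = tree-index path (proj₂ (cover (left (letters a)))) (proj₂ (cover (right (letters a))))

  adjacent : ∀ {a b} → S (a ∷ b ∷ []) → leftTree a ≡ rightTree b
  adjacent {a} {b} ab = edges (lr ab) (proj₂ (cover (left (letters a)))) (proj₂ (cover (right (letters b))))

  -- The sum telescopes modulo 2: by `adjacent`, each letter contributes the colours of its own
  -- right vertex and of the next letter's, and the inner colours cancel. The letter `b` records the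
  -- colour at which the factor ends.
  weight-between : ∀ a u b w → S (a ∷ u ++ b ∷ w) →
    weight letterParity (a ∷ u) ≡ colour (rightTree a) + colour (rightTree b)
  weight-between a [] b w s = begin
    letterParity a + 0ℙ                        ≡⟨ +-identityʳ (letterParity a) ⟩
    colour (rightTree a) + colour (leftTree a) ≡⟨ cong (λ i → colour (rightTree a) + colour i) (adjacent (factorˡ factorial (a ∷ b ∷ []) s)) ⟩
    colour (rightTree a) + colour (rightTree b) ∎
    where open ≡-Reasoning
  weight-between a (c ∷ u) b w s = begin
    letterParity a + weight letterParity (c ∷ u)
      ≡⟨ cong (letterParity a +_) (weight-between c u b w (factorʳ factorial [ a ] s)) ⟩
    (ρ a + colour (leftTree a)) + (ρ c + ρ b)
      ≡⟨ cong (λ i → (ρ a + colour i) + (ρ c + ρ b)) (adjacent (factorˡ factorial (a ∷ c ∷ []) s)) ⟩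
    (ρ a + ρ c) + (ρ c + ρ b)
      ≡⟨ +-assoc (ρ a) (ρ c) (ρ c + ρ b) ⟩
    ρ a + (ρ c + (ρ c + ρ b))
      ≡⟨ cong (ρ a +_) (p+[p+q]≡q (ρ c) (ρ b)) ⟩
    ρ a + ρ b
      ∎
    where
    open ≡-Reasoning
    ρ : A → Parity
    ρ = colour ∘ rightTree

  -- Each tree has a vertex, and from a left vertex some edge leads to a right one in the same tree.
  rightTree-surjective : ∀ i → ∃[ a ] rightTree a ≡ i
  rightTree-surjective i with IsTree.nonempty (trees i)
  ... | inj₂ a , _ , Ta = a , disjoint (proj₂ (cover (right (letters a)))) Ta
  ... | inj₁ a , _ , Ta with extend (letters a)
  -- The biextension of `a` is trimmed on the left to the word `ab`, which is the edge sought.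
  ...   | _ , s with (b , ab) ← (_ , factorʳ factorial [ _ ] s) =
    b , trans (sym (adjacent ab)) (disjoint (proj₂ (cover (left (letters a)))) Ta)

  -- Words supplied by recurrence.

  module _ (recurrent : Recurrent S) where

    open Recurrent recurrent using (recur)

    -- Take `a` and `b` with right vertices in different trees. Recurrence gives `a v b` in `S`, so
    -- `a v` starts and ends at different colours.
    odd-word : ∃[ w ] S w × weight letterParity w ≡ 1ℙ
    odd-word with rightTree-surjective zero | rightTree-surjective (suc zero)
    ... | a , ea | b , eb with recur (letters a) (letters b)
    ...   | v , _ , s = a ∷ v , factorˡ factorial (a ∷ v) s ,
      trans (weight-between a v b [] s) (cong₂ (λ i j → colour i + colour j) ea eb)

    -- In a word `y v y` of `S`, the factor `y v` is followed by its own first letter, so it ends at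
    -- the colour where it started.
    even-extension : ∀ {y} → S y → y ≢ [] → ∃[ v ] S (y ++ v) × weight letterParity (y ++ v) ≡ 0ℙ
    even-extension {[]}    _ y≢[] = ⊥-elim (y≢[] refl)
    even-extension {a ∷ y} s _ with recur s s
    ... | v , _ , s′ = v , factorˡ factorial (a ∷ y ++ v) s″ ,
      trans (weight-between a (y ++ v) a y s″) (p+p≡0ℙ (colour (rightTree a)))
      where
      s″ : S (a ∷ (y ++ v) ++ a ∷ y)
      s″ = subst S (sym (++-assoc (a ∷ y) v (a ∷ y))) s′

proposition4p8 : (A : Set) (n : ℕ) → A ↔ Fin n →
    (θ : A → A) (S : Language A) → Specular θ S → Recurrent S →
    MaximalBifixCode S (EvenCode S) × HasDegree S (EvenCode S) 2
proposition4p8 A n _ θ S specular recurrent =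
  evenCode-maximal factorial π π≡0⇒even π≡1⇒odd (even-extension treeSet recurrent) ,
  (case odd-word treeSet recurrent of λ (w , s , odd) → evenCode-degree factorial π π≡0⇒even π≡1⇒odd s odd)
  where
  open Specular specular using (treeSet)
  open Recurrent recurrent using (factorial)
  π : A → Parity
  π = letterParity treeSet
  π≡0⇒even : ∀ {a} → π a ≡ 0ℙ → EvenLetter S a
  π≡0⇒even = letterParity≡0⇒even treeSet
  π≡1⇒odd : ∀ {a} → π a ≡ 1ℙ → OddLetter S a
  π≡1⇒odd = letterParity≡1⇒odd treeSet
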